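{- Let $n>1$ be an integer and let $P_n$ be the path of order $n$. Then the agglomeration of $P_n$ is $$\phi(P_n)=\frac{3}{n(n+1)}.$$
   Context: All graphs are finite, simple and undirected. The order of a graph is its number of nodes; $d_{uv}$ denotes the length of a shortest path between nodes $u$ and $v$. For a connected graph $H$ of order $m\ge 2$, the agglomeration is $$\phi(H)=\frac{m-1}{\sum_{u,v\in V(H),\,u\ne v} d_{uv}},$$ where the sum is over all ordered pairs $(u,v)$ of distinct nodes (equivalently $\phi(H)=1/(mL(H))$, where $L(H)=\frac{1}{m(m-1)}\sum_{u\neq v}d_{uv}$ is the average path length). -}

module Defs where

open import Data.Fin.Base using (Fin; zero; suc; toℕ; fromℕ<)
open import Data.Fin.Properties using (_≟_; any?; toℕ-injective; toℕ-fromℕ<; toℕ<n)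
open import Data.Integer.Base using (+_)
open import Data.List.Base using (List; map; filter; allFin; cartesianProduct)
open import Data.List.Membership.Propositional using (_∈_)
open import Data.List.Membership.Propositional.Properties
  using (∈-map⁺; ∈-filter⁺; ∈-cartesianProduct⁺; ∈-allFin)
open import Data.List.Relation.Unary.AllPairs as AllPairs using ()
open import Data.List.Relation.Unary.Any using (here; there)
open import Data.List.Relation.Unary.Linked as Linked using (Linked; [-]; _∷_; linked?)
open import Data.List.Relation.Unary.Linked.Properties using (Linked⇒AllPairs)
open import Data.List.Relation.Unary.Unique.Propositional using (Unique)
open import Data.Nat.Base hiding (_/_)
open import Data.Nat.ListAction using (sum)
import Data.Nat.Properties as ℕ
open import Data.Product.Base using (∃; _×_; _,_; proj₁; proj₂; uncurry)
open import Data.Rational.Base using (ℚ; _/_)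
open import Data.Sum.Base using (_⊎_; inj₁; inj₂; swap; [_,_]′)
open import Data.Vec.Base as Vec using (Vec; []; _∷_; head; last; toList)
open import Function.Base using (_∘_; flip)
open import Level using (0ℓ)
open import Relation.Binary.Core using (Rel)
open import Relation.Binary.Definitions using (Symmetric; Irreflexive)
import Relation.Binary.Definitions as Binary
open import Relation.Binary.PropositionalEquality
  using (_≡_; _≢_; refl; sym; trans; cong; subst)
open import Relation.Nullary using (Dec; yes; no; contradiction)
open import Relation.Nullary.Decidable using (map′; ¬?; _×-dec_; _⊎-dec_)
open import Relation.Unary using (Pred; Decidable)

record Graph (m : ℕ) : Set₁ where
  field
    Adj        : Rel (Fin m) 0ℓ
    adj?       : Binary.Decidable Adj
    adj-sym    : Symmetric Adj
    adj-irrefl : Irreflexive _≡_ Adj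

open Graph

-- A path of length k is recorded by its k + 1 successive nodes.
IsPath : ∀ {m} (G : Graph m) (u v : Fin m) {k : ℕ} → Vec (Fin m) (suc k) → Set
IsPath G u v vs =
  head vs ≡ u × last vs ≡ v × Linked (Adj G) (toList vs) × Unique (toList vs)

PathOfLength : ∀ {m} (G : Graph m) (u v : Fin m) → ℕ → Set
PathOfLength {m} G u v k = ∃ λ (vs : Vec (Fin m) (suc k)) → IsPath G u v vs

Connected : ∀ {m} → Graph m → Set
Connected G = ∀ u v → ∃ (PathOfLength G u v)

anyVec? : ∀ {m} k {P : Pred (Vec (Fin m) k) 0ℓ} → Decidable P → Dec (∃ P)
anyVec? zero    P? = map′ (λ p → [] , p) (λ { ([] , p) → p }) (P? [])
anyVec? (suc k) P? =
  map′ (λ (x , xs , p) → x ∷ xs , p) (λ { (x ∷ xs , p) → x , xs , p })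
       (any? λ x → anyVec? k λ xs → P? (x ∷ xs))

pathOfLength? : ∀ {m} (G : Graph m) u v → Decidable (PathOfLength G u v)
pathOfLength? G u v k = anyVec? (suc k) λ vs →
  (head vs ≟ u) ×-dec (last vs ≟ v) ×-dec linked? (adj? G) (toList vs)
    ×-dec AllPairs.allPairs? (λ x y → ¬? (x ≟ y)) (toList vs)

least : {P : Pred ℕ 0ℓ} → Decidable P → ∀ n → P n →
        ∃ λ k → P k × (∀ j → P j → k ≤ j)
least P? zero    p = zero , p , λ _ _ → z≤n
least P? (suc n) p with P? zero
... | yes p₀ = zero , p₀ , λ _ _ → z≤n
... | no ¬p₀ with least (P? ∘ suc) n p
...   | k , pₖ , k-least = suc k , pₖ , λ where
        zero    q → contradiction q ¬p₀
        (suc j) q → s≤s (k-least j q)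

module _ {m} (G : Graph m) (conn : Connected G) where

  private
    shortest : ∀ u v → ∃ λ k → PathOfLength G u v k × (∀ j → PathOfLength G u v j → k ≤ j)
    shortest u v = uncurry (least (pathOfLength? G u v)) (conn u v)

  dist : Fin m → Fin m → ℕ
  dist u v = proj₁ (shortest u v)

  dist-path : ∀ u v → PathOfLength G u v (dist u v)
  dist-path u v = proj₁ (proj₂ (shortest u v))

  dist-least : ∀ u v k → PathOfLength G u v k → dist u v ≤ k
  dist-least u v = proj₂ (proj₂ (shortest u v))

  distinctPairs : List (Fin m × Fin m)
  distinctPairs =
    filter (λ (u , v) → ¬? (u ≟ v)) (cartesianProduct (allFin m) (allFin m))

  distanceSum : ℕ
  distanceSum = sum (map (λ (u , v) → dist u v) distinctPairs)

  dist-pos : ∀ {u v} → u ≢ v → 0 < dist u v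
  dist-pos {u} {v} u≢v = positive (dist-path u v)
    where
    positive : ∀ {k} → PathOfLength G u v k → 0 < k
    positive {zero}  (x ∷ [] , x≡u , x≡v , _) = contradiction (trans (sym x≡u) x≡v) u≢v
    positive {suc k} _                        = z<s

∈⇒≤sum : ∀ {x xs} → x ∈ xs → x ≤ sum xs
∈⇒≤sum (here refl)        = ℕ.m≤m+n _ _
∈⇒≤sum (there {x = y} x∈) = ℕ.≤-trans (∈⇒≤sum x∈) (ℕ.m≤n+m _ y)

distanceSum-nonZero : ∀ {m} .{{_ : NonTrivial m}} (G : Graph m) (conn : Connected G) →
                      NonZero (distanceSum G conn)
distanceSum-nonZero {2+ m} G conn = >-nonZero
  (ℕ.<-≤-trans (dist-pos G conn {zero} {suc zero} λ ())
    (∈⇒≤sum (∈-map⁺ (λ (u , v) → dist G conn u v)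
      (∈-filter⁺ (λ (u , v) → ¬? (u ≟ v))
        (∈-cartesianProduct⁺ (∈-allFin zero) (∈-allFin (suc zero))) λ ()))))

agglomeration : ∀ {m} .{{_ : NonTrivial m}} (G : Graph m) → Connected G → ℚ
agglomeration {m} G conn =
  _/_ (+ (m ∸ 1)) (distanceSum G conn) {{distanceSum-nonZero G conn}}

Next : ∀ {n} → Rel (Fin n) 0ℓ
Next i j = toℕ j ≡ suc (toℕ i)

pathGraph : ∀ n → Graph n
pathGraph n = record
  { Adj        = λ i j → Next i j ⊎ Next j i
  ; adj?       = λ i j → (toℕ j ℕ.≟ suc (toℕ i)) ⊎-dec (toℕ i ℕ.≟ suc (toℕ j))
  ; adj-sym    = swap
  ; adj-irrefl = λ { refl → [ ℕ.1+n≢n ∘ sym , ℕ.1+n≢n ∘ sym ]′ }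
  }

last-∷ : ∀ {A : Set} {n} (x : A) (xs : Vec A (suc n)) → last (x ∷ xs) ≡ last xs
last-∷ x xs with Vec.initLast xs
... | _ , _ , _ = refl

LinkedFromTo : ∀ {n} → Rel (Fin n) 0ℓ → Fin n → Fin n → ℕ → Set
LinkedFromTo {n} R u v k =
  ∃ λ (vs : Vec (Fin n) (suc k)) → head vs ≡ u × last vs ≡ v × Linked R (toList vs)

prepend : ∀ {n} {R : Rel (Fin n) 0ℓ} {u w v k} →
          R u w → LinkedFromTo R w v k → LinkedFromTo R u v (suc k)
prepend {u = u} r (w ∷ ws , refl , last≡v , linked) =
  u ∷ w ∷ ws , refl , trans (last-∷ u (w ∷ ws)) last≡v , r ∷ linked

ascending : ∀ {n} k {i j : Fin n} → toℕ j ≡ k + toℕ i → LinkedFromTo Next i j k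
ascending zero    {i} eq = i ∷ [] , refl , toℕ-injective (sym eq) , [-]
ascending {n} (suc k) {i} {j} eq = prepend (toℕ-fromℕ< 1+i<n) (ascending k eq′)
  where
  1+i<n : suc (toℕ i) < n
  1+i<n = ℕ.≤-<-trans (subst (suc (toℕ i) ≤_) (sym eq) (s≤s (ℕ.m≤n+m (toℕ i) k))) (toℕ<n j)
  eq′ : toℕ j ≡ k + toℕ (fromℕ< 1+i<n)
  eq′ = trans eq (trans (sym (ℕ.+-suc k (toℕ i))) (cong (_+_ k) (sym (toℕ-fromℕ< 1+i<n))))

descending : ∀ {n} k {i j : Fin n} → toℕ i ≡ k + toℕ j → LinkedFromTo (flip Next) i j k
descending zero    {i} eq = i ∷ [] , refl , toℕ-injective eq , [-]
descending {n} (suc k) {i} {j} eq =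
  prepend (trans eq (cong suc (sym (toℕ-fromℕ< k+j<n)))) (descending k (toℕ-fromℕ< k+j<n))
  where
  k+j<n : k + toℕ j < n
  k+j<n = ℕ.<-trans (ℕ.≤-reflexive (sym eq)) (toℕ<n i)

pathGraph-connected : ∀ n → Connected (pathGraph n)
pathGraph-connected n u v with ℕ.≤-total (toℕ u) (toℕ v)
... | inj₁ u≤v with ascending _ (sym (ℕ.m∸n+n≡m u≤v))
...   | vs , head≡ , last≡ , linked = _ , vs , head≡ , last≡ , Linked.map inj₁ linked ,
        AllPairs.map (λ { x<y refl → ℕ.<-irrefl refl x<y })
          (Linked⇒AllPairs {R = λ x y → toℕ x < toℕ y} ℕ.<-trans
            (Linked.map (ℕ.≤-reflexive ∘ sym) linked))
pathGraph-connected n u v | inj₂ v≤u with descending _ (sym (ℕ.m∸n+n≡m v≤u))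
...   | vs , head≡ , last≡ , linked = _ , vs , head≡ , last≡ , Linked.map inj₂ linked ,
        AllPairs.map (λ { y<x refl → ℕ.<-irrefl refl y<x })
          (Linked⇒AllPairs {R = λ x y → toℕ y < toℕ x} (flip ℕ.<-trans)
            (Linked.map (ℕ.≤-reflexive ∘ sym) linked))

n*[n+1]-nonZero : ∀ n → .{{NonTrivial n}} → NonZero (n * (n + 1))
n*[n+1]-nonZero (2+ _) = _

{-# OPTIONS --safe #-}

-- In the path graph the distance of u and v is |u − v|: the monotone walk attains it, and every
-- step changes the index by exactly 1. Let S(n) be the sum of |i − j| over 0 ≤ i, j < n. Removing
-- node 0 gives S(n+1) = n(n+1) + S(n), hence 3 S(n) = (n−1) n (n+1).

module Submission where

open import Defs
import Algebra.Properties.CommutativeMonoid.Sum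
open import Data.Fin.Base as Fin using (Fin; toℕ)
open import Data.Fin.Properties using (_≟_)
open import Data.Integer.Base using (+_)
import Data.Integer.Properties as ℤ
open import Data.List.Base using ([]; _∷_; _++_; map; filter; tabulate; allFin; cartesianProduct)
open import Data.List.Properties using (map-++; map-∘; map-tabulate)
open import Data.List.Relation.Unary.Linked using (Linked; _∷_)
open import Data.Nat.Base using (ℕ; zero; suc; 2+; NonTrivial; NonZero; _+_; _*_; _∸_; _≤_; ∣_-_∣)
open import Data.Nat.ListAction using (sum)
open import Data.Nat.ListAction.Properties using (sum-++)
import Data.Nat.Properties as ℕ
open import Data.Nat.Tactic.RingSolver using (solve-∀)
open import Data.Product.Base using (_×_; _,_; proj₁; proj₂; uncurry)
open import Data.Rational.Base using (_/_)
open import Data.Rational.Properties using (fromℚᵘ-cong)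
open import Data.Rational.Unnormalised.Base using (mkℚᵘ; *≡*)
open import Data.Sum.Base using (inj₁; inj₂)
open import Data.Vec.Base using (Vec; []; _∷_; last; toList)
open import Function.Base using (_∘_)
open import Level using (0ℓ)
open import Relation.Binary.PropositionalEquality
  using (_≡_; refl; sym; trans; cong; cong₂; module ≡-Reasoning)
open import Relation.Nullary using (¬_; yes; no)
open import Relation.Nullary.Decidable using (¬?; decidable-stable)
open import Relation.Unary using (Pred; Decidable)

open Graph
open Algebra.Properties.CommutativeMonoid.Sum ℕ.+-0-commutativeMonoid
  using (sum-syntax; ∑-distrib-+; sum-cong-≗)

adj⇒∣-∣≡1 : ∀ {n} {i j : Fin n} → Adj (pathGraph n) i j → ∣ toℕ i - toℕ j ∣ ≡ 1
adj⇒∣-∣≡1 {i = i} (inj₁ j≡1+i) rewrite j≡1+i = ∣n-1+n∣≡1 (toℕ i)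
  where
  ∣n-1+n∣≡1 : ∀ n → ∣ n - suc n ∣ ≡ 1
  ∣n-1+n∣≡1 zero    = refl
  ∣n-1+n∣≡1 (suc n) = ∣n-1+n∣≡1 n
adj⇒∣-∣≡1 {i = i} {j} (inj₂ i≡1+j) =
  trans (ℕ.∣-∣-comm (toℕ i) (toℕ j)) (adj⇒∣-∣≡1 {i = j} {i} (inj₁ i≡1+j))

-- Induction along the walk: by the triangle inequality every edge adds at most its index change,
-- which is 1. This is the lower bound for the distance.
linked⇒∣-∣≤length : ∀ {n k} (x : Fin n) (xs : Vec (Fin n) k) →
  Linked (Adj (pathGraph n)) (toList (x ∷ xs)) → ∣ toℕ x - toℕ (last (x ∷ xs)) ∣ ≤ k
linked⇒∣-∣≤length x [] _ = ℕ.≤-reflexive (ℕ.∣n-n∣≡0 (toℕ x))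
linked⇒∣-∣≤length {k = suc k} x (y ∷ ys) (x~y ∷ linked) = begin
  ∣ toℕ x - toℕ (last (x ∷ y ∷ ys)) ∣
    ≡⟨ cong (λ z → ∣ toℕ x - toℕ z ∣) (last-∷ x (y ∷ ys)) ⟩
  ∣ toℕ x - toℕ (last (y ∷ ys)) ∣
    ≤⟨ ℕ.∣-∣-triangle (toℕ x) (toℕ y) _ ⟩
  ∣ toℕ x - toℕ y ∣ + ∣ toℕ y - toℕ (last (y ∷ ys)) ∣
    ≤⟨ ℕ.+-mono-≤ (ℕ.≤-reflexive (adj⇒∣-∣≡1 {i = x} {y} x~y)) (linked⇒∣-∣≤length y ys linked) ⟩
  suc k ∎
  where open ℕ.≤-Reasoning

pathOfLength⇒∣-∣≤ : ∀ {n k} {u v : Fin n} →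
  PathOfLength (pathGraph n) u v k → ∣ toℕ u - toℕ v ∣ ≤ k
pathOfLength⇒∣-∣≤ (x ∷ xs , refl , refl , linked , _) = linked⇒∣-∣≤length x xs linked

pathGraph-connected-length : ∀ n u v →
  proj₁ (pathGraph-connected n u v) ≡ ∣ toℕ u - toℕ v ∣
-- The cases follow the definition of `pathGraph-connected`, so that its length computes to the
-- larger index minus the smaller.
pathGraph-connected-length n u v with ℕ.≤-total (toℕ u) (toℕ v)
... | inj₁ u≤v with ascending _ {u} {v} (sym (ℕ.m∸n+n≡m u≤v))
...   | _ , _ , _ , _ = sym (ℕ.m≤n⇒∣m-n∣≡n∸m u≤v)
pathGraph-connected-length n u v | inj₂ v≤u with descending _ {u} {v} (sym (ℕ.m∸n+n≡m v≤u))
...   | _ , _ , _ , _ = sym (ℕ.m≤n⇒∣n-m∣≡n∸m v≤u)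

dist-pathGraph : ∀ n u v → dist (pathGraph n) (pathGraph-connected n) u v ≡ ∣ toℕ u - toℕ v ∣
dist-pathGraph n u v = ℕ.≤-antisym
  (ℕ.≤-trans
    (dist-least (pathGraph n) (pathGraph-connected n) u v _ (proj₂ (pathGraph-connected n u v)))
    (ℕ.≤-reflexive (pathGraph-connected-length n u v)))
  (pathOfLength⇒∣-∣≤ (dist-path (pathGraph n) (pathGraph-connected n) u v))

-- Serves to put the diagonal pairs, which `distinctPairs` leaves out, back into the distance sum.
sum-map-filter : ∀ {A : Set} {P : Pred A 0ℓ} (P? : Decidable P) (f : A → ℕ) →
  (∀ x → ¬ P x → f x ≡ 0) → ∀ xs → sum (map f (filter P? xs)) ≡ sum (map f xs)
sum-map-filter P? f f≡0 [] = refl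
sum-map-filter P? f f≡0 (x ∷ xs) with P? x
... | yes _  = cong (_+_ (f x)) (sum-map-filter P? f f≡0 xs)
... | no ¬px rewrite f≡0 x ¬px = sum-map-filter P? f f≡0 xs

sum-map-cartesianProduct : ∀ {A B : Set} (f : A × B → ℕ) xs ys →
  sum (map f (cartesianProduct xs ys)) ≡ sum (map (λ x → sum (map (λ y → f (x , y)) ys)) xs)
sum-map-cartesianProduct f []       ys = refl
sum-map-cartesianProduct f (x ∷ xs) ys = begin
  sum (map f (map (x ,_) ys ++ cartesianProduct xs ys))
    ≡⟨ cong sum (map-++ f (map (x ,_) ys) _) ⟩
  sum (map f (map (x ,_) ys) ++ map f (cartesianProduct xs ys))
    ≡⟨ sum-++ (map f (map (x ,_) ys)) _ ⟩
  sum (map f (map (x ,_) ys)) + sum (map f (cartesianProduct xs ys))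
    ≡⟨ cong₂ _+_ (cong sum (sym (map-∘ ys))) (sum-map-cartesianProduct f xs ys) ⟩
  sum (map (λ y → f (x , y)) ys) + sum (map (λ x → sum (map (λ y → f (x , y)) ys)) xs) ∎
  where open ≡-Reasoning

-- Passes from lists to sums over `Fin n`, where the term at node 0 splits off by computation and
-- `∑-distrib-+` applies.
sum-map-allFin : ∀ {n} (f : Fin n → ℕ) → sum (map f (allFin n)) ≡ ∑[ i < n ] f i
sum-map-allFin f = trans (cong sum (map-tabulate (λ i → i) f)) (sum-tabulate f)
  where
  sum-tabulate : ∀ {n} (f : Fin n → ℕ) → sum (tabulate f) ≡ ∑[ i < n ] f i
  sum-tabulate {zero}  f = refl
  sum-tabulate {suc n} f = cong (_+_ (f Fin.zero)) (sum-tabulate (f ∘ Fin.suc))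

distanceSum-∑ : ∀ {m} (G : Graph m) (conn : Connected G) →
  (∀ u → dist G conn u u ≡ 0) →
  distanceSum G conn ≡ ∑[ u < m ] ∑[ v < m ] dist G conn u v
distanceSum-∑ {m} G conn dist-refl = begin
  distanceSum G conn
    ≡⟨ sum-map-filter (λ (u , v) → ¬? (u ≟ v)) (uncurry (dist G conn)) vanishes
         (cartesianProduct (allFin m) (allFin m)) ⟩
  sum (map (uncurry (dist G conn)) (cartesianProduct (allFin m) (allFin m)))
    ≡⟨ sum-map-cartesianProduct (uncurry (dist G conn)) (allFin m) (allFin m) ⟩
  sum (map (λ u → sum (map (dist G conn u) (allFin m))) (allFin m))
    ≡⟨ sum-map-allFin (λ u → sum (map (dist G conn u) (allFin m))) ⟩
  ∑[ u < m ] sum (map (dist G conn u) (allFin m))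
    ≡⟨ sum-cong-≗ {m} (λ u → sum-map-allFin (dist G conn u)) ⟩
  ∑[ u < m ] ∑[ v < m ] dist G conn u v ∎
  where
  open ≡-Reasoning
  -- The filter tests `u ≢ v`, so a dropped pair yields only a double negation, which decidable
  -- equality removes.
  vanishes : ∀ ((u , v) : Fin m × Fin m) → ¬ ¬ u ≡ v → dist G conn u v ≡ 0
  vanishes (u , v) ¬u≢v with refl ← decidable-stable (u ≟ v) ¬u≢v = dist-refl u

-- The offset `a` is there for the induction: splitting off the first term shifts the remaining
-- indices, which turns `a` into `suc a`. The factor 2 avoids division.
2*∑[1+a+i] : ∀ n a → 2 * (∑[ i < n ] suc (a + toℕ i)) ≡ n * suc (2 * a + n)
2*∑[1+a+i] zero    a = refl
2*∑[1+a+i] (suc n) a = begin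
  2 * (suc (a + 0) + ∑[ i < n ] suc (a + suc (toℕ i)))
    ≡⟨ cong (λ s → 2 * (suc (a + 0) + s))
         (sum-cong-≗ {n} (λ i → cong suc (ℕ.+-suc a (toℕ i)))) ⟩
  2 * (suc (a + 0) + ∑[ i < n ] suc (suc a + toℕ i))
    ≡⟨ ℕ.*-distribˡ-+ 2 (suc (a + 0)) _ ⟩
  2 * suc (a + 0) + 2 * (∑[ i < n ] suc (suc a + toℕ i))
    ≡⟨ cong (_+_ (2 * suc (a + 0))) (2*∑[1+a+i] n (suc a)) ⟩
  2 * suc (a + 0) + n * suc (2 * suc a + n)
    ≡⟨ factor n a ⟩
  suc n * suc (2 * a + suc n) ∎
  where
  open ≡-Reasoning
  factor : ∀ n a → 2 * suc (a + 0) + n * suc (2 * suc a + n) ≡ suc n * suc (2 * a + suc n)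
  factor = solve-∀

∑∑∣i-j∣ : ℕ → ℕ
∑∑∣i-j∣ n = ∑[ i < n ] ∑[ j < n ] ∣ toℕ i - toℕ j ∣

-- Splits off the row and the column of node 0.
∑∑∣i-j∣-suc : ∀ n → ∑∑∣i-j∣ (suc n) ≡ 2 * (∑[ i < n ] suc (toℕ i)) + ∑∑∣i-j∣ n
∑∑∣i-j∣-suc n = begin
  r + ∑[ i < n ] (suc (toℕ i) + ∑[ j < n ] ∣ toℕ i - toℕ j ∣)
    ≡⟨ cong (_+_ r) (∑-distrib-+ {n} (suc ∘ toℕ) _) ⟩
  r + (r + ∑∑∣i-j∣ n)
    ≡⟨ regroup r (∑∑∣i-j∣ n) ⟩
  2 * r + ∑∑∣i-j∣ n ∎
  where
  open ≡-Reasoning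
  r = ∑[ i < n ] suc (toℕ i)
  regroup : ∀ r s → r + (r + s) ≡ 2 * r + s
  regroup = solve-∀

-- Stated at `suc n`, so that the factor (order - 1) is `n` itself and no truncated subtraction
-- enters the ring identity.
3*∑∑∣i-j∣ : ∀ n → 3 * ∑∑∣i-j∣ (suc n) ≡ n * (suc n * (suc n + 1))
3*∑∑∣i-j∣ zero    = refl
3*∑∑∣i-j∣ (suc n) = begin
  3 * ∑∑∣i-j∣ (2+ n)
    ≡⟨ cong (3 *_) (∑∑∣i-j∣-suc (suc n)) ⟩
  3 * (2 * (∑[ i < suc n ] suc (toℕ i)) + ∑∑∣i-j∣ (suc n))
    -- Offset 0 gives twice the triangular number 1 + ... + (n + 1).
    ≡⟨ cong (λ t → 3 * (t + ∑∑∣i-j∣ (suc n))) (2*∑[1+a+i] (suc n) 0) ⟩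
  3 * (suc n * 2+ n + ∑∑∣i-j∣ (suc n))
    ≡⟨ ℕ.*-distribˡ-+ 3 (suc n * 2+ n) _ ⟩
  3 * (suc n * 2+ n) + 3 * ∑∑∣i-j∣ (suc n)
    ≡⟨ cong (_+_ (3 * (suc n * 2+ n))) (3*∑∑∣i-j∣ n) ⟩
  3 * (suc n * 2+ n) + n * (suc n * (suc n + 1))
    ≡⟨ factor n ⟩
  suc n * (2+ n * (2+ n + 1)) ∎
  where
  open ≡-Reasoning
  factor : ∀ n → 3 * (suc n * 2+ n) + n * (suc n * (suc n + 1)) ≡ suc n * (2+ n * (2+ n + 1))
  factor = solve-∀

distanceSum-pathGraph : ∀ n → distanceSum (pathGraph n) (pathGraph-connected n) ≡ ∑∑∣i-j∣ n
distanceSum-pathGraph n = trans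
  (distanceSum-∑ (pathGraph n) (pathGraph-connected n)
    (λ u → trans (dist-pathGraph n u u) (ℕ.∣n-n∣≡0 (toℕ u))))
  (sum-cong-≗ {n} (λ u → sum-cong-≗ {n} (dist-pathGraph n u)))

-- `_/_` reduces to lowest terms, so the proof goes through unnormalised rationals: their equality
-- is cross multiplication, and normalisation respects it.
*≡*⇒/≡/ : ∀ a b c d .{{b≢0 : NonZero b}} .{{d≢0 : NonZero d}} →
  a * d ≡ c * b → + a / b ≡ + c / d
*≡*⇒/≡/ a (suc b) c (suc d) eq = fromℚᵘ-cong {mkℚᵘ (+ a) b} {mkℚᵘ (+ c) d}
  (*≡* (trans (sym (ℤ.pos-* a (suc d))) (trans (cong +_ eq) (ℤ.pos-* c (suc b)))))

agglomeration-≡ : ∀ {m} .{{_ : NonTrivial m}} (G : Graph m) (conn : Connected G) p q .{{_ : NonZero q}} →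
  (m ∸ 1) * q ≡ p * distanceSum G conn → agglomeration G conn ≡ + p / q
agglomeration-≡ {m} G conn p q =
  *≡*⇒/≡/ (m ∸ 1) (distanceSum G conn) p q {{distanceSum-nonZero G conn}}

lemma2p1p1 : (n : ℕ) .{{_ : NonTrivial n}} →
    agglomeration (pathGraph n) (pathGraph-connected n)
    ≡ _/_ (+ 3) (n * (n + 1)) {{n*[n+1]-nonZero n}}
lemma2p1p1 n = agglomeration-≡ (pathGraph n) (pathGraph-connected n) 3 (n * (n + 1))
  {{n*[n+1]-nonZero n}} (cross n)
  where
  cross : ∀ n .{{_ : NonTrivial n}} →
    (n ∸ 1) * (n * (n + 1)) ≡ 3 * distanceSum (pathGraph n) (pathGraph-connected n)
  -- `NonTrivial` rules out order 0, and at `suc n` the subtraction `suc n ∸ 1` computes to `n`.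
  cross (suc n) = sym (trans (cong (3 *_) (distanceSum-pathGraph (suc n))) (3*∑∑∣i-j∣ n))
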